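{- Let $H_{44}$ and $H_{521}$ be the term-normalized complete homogeneous symmetric polynomials in three variables $x_1,x_2,x_3$ associated to the partitions $(4,4)$ and $(5,2,1)$ of $8$. Then the polynomial $(H_{44}-H_{521})(x_1^2,x_2^2,x_3^2)$ is a sum of squares of polynomials with rational coefficients (in fact a positive rational combination of $41$ squares), so $H_{44}-H_{521}\ge 0$ on $\mathbb{R}^3_{\ge 0}$, while the partitions $(4,4)$ and $(5,2,1)$ are incomparable in dominance order. Thus $H_{44}-H_{521}$ is a counterexample to the statement "$H_\mu - H_\lambda \geq 0$ on the nonnegative orthant implies $\mu$ dominates $\lambda$", and it is degree-minimal: there is no pair of dominance-incomparable partitions $\lambda,\mu$ with $|\lambda|=|\mu|\le 7$ such that $H_\mu-H_\lambda\ge 0$ on the nonnegative orthant.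
   Context: For an integer $d\ge 0$, $h_d(x_1,\dots,x_n)$ denotes the sum of all monomials of degree $d$ in $x_1,\dots,x_n$ (with $h_0=1$), and for a partition $\lambda=(\lambda_1\ge\lambda_2\ge\cdots)$ one sets $h_\lambda=\prod_i h_{\lambda_i}$. The term-normalized version is $H_\lambda(x)=h_\lambda(x)/h_\lambda(1,\dots,1)$. For partitions $\lambda,\mu$ of the same integer, $\mu$ dominates $\lambda$ (written $\mu\succeq\lambda$) if $\mu_1+\cdots+\mu_k\ge\lambda_1+\cdots+\lambda_k$ for all $k$; $\lambda,\mu$ are incomparable if neither dominates the other. A polynomial is a sum of squares if it equals $\sum_i d_i q_i^2$ with $d_i>0$ and $q_i$ polynomials. Explicitly, $(H_{44}-H_{521})(x_1^2,x_2^2,x_3^2)=\frac{1}{9450}\big(17\sum x_i^{16}+9\sum_{i\ne j} x_i^{14}x_j^{2}+\sum_{i\ne j}x_i^{12}x_j^4+18\sum_{i\ne j}x_i^{10}x_j^6+60\sum_{i<j}x_i^8x_j^8-32\sum x_i^{12}x_j^2x_k^2-6\cdot(\ldots)\big)$ as given in the paper; its nonnegativity is meant on $\mathbb{R}^3_{\ge0}$ for the three-variable polynomial. -}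

module Defs where

open import Level using (0ℓ)
open import Algebra.Bundles using (RawRing)
import Algebra.Definitions.RawSemiring as RawSemiringDefinitions
open import Data.Nat as ℕ using (ℕ; zero; suc)
import Data.Nat.Properties as ℕ
open import Data.Nat.ListAction using (sum)
open import Data.Rational using (ℚ; 0ℚ; 1ℚ; ½; _+_; _*_; _-_; -_; _<_; _≤_; ∣_∣; 1/_; NonZero; ≢-nonZero; Positive; positive; nonNegative)
open import Data.Rational.Base using (+-*-rawRing)
open import Data.Rational.Properties
open import Data.Rational.Solver using (module +-*-Solver)
open import Data.Fin using (Fin)
open import Data.List as List using (List; []; _∷_; _++_; upTo; concatMap; cartesianProductWith)
open import Data.List.Relation.Unary.All using (All; []; _∷_)
open import Data.List.Relation.Unary.Linked using (Linked; [-]; _∷_)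
open import Data.Vec as Vec using (Vec; []; _∷_)
open import Data.Vec.Properties using (≡-dec)
import Data.Vec.Relation.Unary.All as VecAll
open import Data.Product using (Σ-syntax; ∃-syntax; _×_; _,_)
open import Relation.Nullary using (¬_; yes; no)
open import Relation.Nullary.Decidable using (from-yes)
open import Relation.Binary.PropositionalEquality using (_≡_; refl; sym; trans; cong; cong₂; subst)

-- λ being reserved, the partition usually called λ is written ν throughout.
record Partition : Set where
  constructor partition
  field
    parts         : List ℕ
    nonincreasing : Linked ℕ._≥_ parts
    positiveParts : All (ℕ._<_ 0) parts

open Partition public

size : Partition → ℕ
size ν = sum (parts ν)

infix 4 _⪰_

-- `take k` is the whole list once k exceeds its length, so the shorter
-- partition is implicitly padded with zeros.
_⪰_ : Partition → Partition → Set
μ ⪰ ν = ∀ k → sum (List.take k (parts ν)) ℕ.≤ sum (List.take k (parts μ))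

Incomparable : Partition → Partition → Set
Incomparable ν μ = ¬ (μ ⪰ ν) × ¬ (ν ⪰ μ)

p44 : Partition
p44 = partition (4 ∷ 4 ∷ [])
  (from-yes (4 ℕ.≤? 4) ∷ [-])
  (from-yes (1 ℕ.≤? 4) ∷ from-yes (1 ℕ.≤? 4) ∷ [])

p521 : Partition
p521 = partition (5 ∷ 2 ∷ 1 ∷ [])
  (from-yes (2 ℕ.≤? 5) ∷ from-yes (1 ℕ.≤? 2) ∷ [-])
  (from-yes (1 ℕ.≤? 5) ∷ from-yes (1 ℕ.≤? 2) ∷ from-yes (1 ℕ.≤? 1) ∷ [])

-- A polynomial in ℚ[x₁,…,xₙ] is a formal sum of terms c·x^α; a monomial may occur in
-- several terms, so equality is _≈ᴾ_ below and never _≡_ on term lists.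
Poly : ℕ → Set
Poly n = List (ℚ × Vec ℕ n)

coeff : ∀ {n} → Poly n → Vec ℕ n → ℚ
coeff []            α = 0ℚ
coeff ((c , β) ∷ p) α with ≡-dec ℕ._≟_ β α
... | yes _ = c + coeff p α
... | no  _ = coeff p α

infix  4 _≈ᴾ_
infixl 6 _+ᴾ_ _-ᴾ_
infixl 7 _*ᴾ_

_≈ᴾ_ : ∀ {n} → Poly n → Poly n → Set
p ≈ᴾ q = ∀ α → coeff p α ≡ coeff q α

constᴾ : ∀ {n} → ℚ → Poly n
constᴾ c = (c , Vec.replicate _ 0) ∷ []

var : ∀ {n} → Fin n → Poly n
var i = (1ℚ , Vec.updateAt (Vec.replicate _ 0) i suc) ∷ []

_+ᴾ_ : ∀ {n} → Poly n → Poly n → Poly n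
_+ᴾ_ = _++_

-ᴾ_ : ∀ {n} → Poly n → Poly n
-ᴾ_ = List.map λ (c , α) → - c , α

_-ᴾ_ : ∀ {n} → Poly n → Poly n → Poly n
p -ᴾ q = p +ᴾ (-ᴾ q)

_*ᴾ_ : ∀ {n} → Poly n → Poly n → Poly n
_*ᴾ_ = cartesianProductWith λ (c , α) (d , β) → c * d , Vec.zipWith ℕ._+_ α β

polyRawRing : ℕ → RawRing 0ℓ 0ℓ
polyRawRing n = record
  { Carrier = Poly n
  ; _≈_     = _≈ᴾ_
  ; _+_     = _+ᴾ_
  ; _*_     = _*ᴾ_
  ; -_      = -ᴾ_
  ; 0#      = []
  ; 1#      = constᴾ 1ℚ
  }

module Evaluation {c ℓ} (R : RawRing c ℓ) (ι : ℚ → RawRing.Carrier R) where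
  private module R = RawRing R
  open RawSemiringDefinitions R.rawSemiring using (_^_)

  monomial : ∀ {n} → Vec ℕ n → Vec R.Carrier n → R.Carrier
  monomial []      []       = R.1#
  monomial (k ∷ α) (x ∷ xs) = (x ^ k) R.* monomial α xs

  eval : ∀ {n} → Poly n → Vec R.Carrier n → R.Carrier
  eval []            xs = R.0#
  eval ((c , α) ∷ p) xs = (ι c R.* monomial α xs) R.+ eval p xs

evalℚ : ∀ {n} → Poly n → Vec ℚ n → ℚ
evalℚ = Evaluation.eval +-*-rawRing (λ c → c)

squareVariables : ∀ {n} → Poly n → Poly n
squareVariables {n} p =
  Evaluation.eval (polyRawRing n) constᴾ p (Vec.tabulate λ i → var i *ᴾ var i)

weightedSquares : ∀ {n k} → Vec (ℚ × Poly n) k → Poly n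
weightedSquares = Vec.foldr′ (λ (d , q) s → (constᴾ d *ᴾ (q *ᴾ q)) +ᴾ s) []

-- p = d₁q₁² + ⋯ + dₖqₖ² with rational dᵢ > 0 and qᵢ ∈ ℚ[x₁,…,xₙ]
IsSumOfSquares : ∀ {n} → ℕ → Poly n → Set
IsSumOfSquares {n} k p =
  Σ[ dqs ∈ Vec (ℚ × Poly n) k ]
    VecAll.All (λ (d , _) → 0ℚ < d) dqs × p ≈ᴾ weightedSquares dqs

exponents : ∀ n → ℕ → List (Vec ℕ n)
exponents zero    zero    = [] ∷ []
exponents zero    (suc _) = []
exponents (suc n) d       =
  concatMap (λ k → List.map (k ∷_) (exponents n (d ℕ.∸ k))) (upTo (suc d))

hᵈ : ∀ n → ℕ → Poly n
hᵈ n d = List.map (1ℚ ,_) (exponents n d)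

h : ∀ n → Partition → Poly n
h n ν = List.foldr (λ d p → hᵈ n d *ᴾ p) (constᴾ 1ℚ) (parts ν)

-- Total reciprocal with 1/0 = 0.  The zero case is only reached below by
-- h_ν(1,…,1) for n = 0, since this number is positive for n ≥ 1.
recip : ℚ → ℚ
recip q with q ≟ 0ℚ
... | yes _   = 0ℚ
... | no  q≢0 = (1/ q) {{≢-nonZero q≢0}}

H : ∀ n → Partition → Poly n
H n ν = constᴾ (recip (evalℚ (h n ν) (Vec.replicate n 1ℚ))) *ᴾ h n ν

-- Real numbers are Cauchy sequences of rationals up to _≈ᴿ_; the order is the
-- order of the limits: x ≤ y + ε eventually, for every ε > 0.
IsCauchy : (ℕ → ℚ) → Set
IsCauchy s = ∀ ε → 0ℚ < ε →
  ∃[ N ] (∀ m n → N ℕ.≤ m → N ℕ.≤ n → ∣ s m - s n ∣ < ε)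

record ℝ : Set where
  constructor real
  field
    seq    : ℕ → ℚ
    cauchy : IsCauchy seq

open ℝ public

infix 4 _≤ᴿ_ _≈ᴿ_

_≤ᴿ_ : ℝ → ℝ → Set
x ≤ᴿ y = ∀ ε → 0ℚ < ε → ∃[ N ] (∀ n → N ℕ.≤ n → seq x n ≤ seq y n + ε)

_≈ᴿ_ : ℝ → ℝ → Set
x ≈ᴿ y = x ≤ᴿ y × y ≤ᴿ x

fromℚ : ℚ → ℝ
fromℚ q = real (λ _ → q) λ ε ε>0 → 0 , λ _ _ _ _ →
  subst (_< ε) (sym (cong ∣_∣ (+-inverseʳ q))) ε>0

half>0 : ∀ {ε} → 0ℚ < ε → 0ℚ < ½ * ε
half>0 {ε} ε>0 = subst (_< ½ * ε) (*-zeroʳ ½) (*-monoʳ-<-pos ½ ε>0)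

half+half : ∀ ε → ½ * ε + ½ * ε ≡ ε
half+half ε = trans (sym (*-distribʳ-+ ε ½ ½)) (*-identityˡ ε)

+-cauchy : ∀ s t → IsCauchy s → IsCauchy t → IsCauchy (λ n → s n + t n)
+-cauchy s t cs ct ε ε>0 =
  let M , closeₛ = cs (½ * ε) (half>0 ε>0)
      N , closeₜ = ct (½ * ε) (half>0 ε>0)
  in M ℕ.⊔ N , λ m n ≤m ≤n → begin-strict
    ∣ (s m + t m) - (s n + t n) ∣    ≡⟨ cong ∣_∣ (rearrange (s m) (t m) (s n) (t n)) ⟩
    ∣ (s m - s n) + (t m - t n) ∣    ≤⟨ ∣p+q∣≤∣p∣+∣q∣ (s m - s n) (t m - t n) ⟩
    ∣ s m - s n ∣ + ∣ t m - t n ∣    <⟨ +-mono-<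
                                          (closeₛ m n (ℕ.m⊔n≤o⇒m≤o M N ≤m) (ℕ.m⊔n≤o⇒m≤o M N ≤n))
                                          (closeₜ m n (ℕ.m⊔n≤o⇒n≤o M N ≤m) (ℕ.m⊔n≤o⇒n≤o M N ≤n)) ⟩
    ½ * ε + ½ * ε                    ≡⟨ half+half ε ⟩
    ε                                ∎
  where
  open ≤-Reasoning
  rearrange : ∀ a b c d → (a + b) - (c + d) ≡ (a - c) + (b - d)
  rearrange = solve 4 (λ a b c d → (a :+ b) :- (c :+ d) := (a :- c) :+ (b :- d)) refl
    where open +-*-Solver

neg-cauchy : ∀ s → IsCauchy s → IsCauchy (λ n → - s n)
neg-cauchy s cs ε ε>0 =
  let N , close = cs ε ε>0
  in N , λ m n ≤m ≤n → subst (_< ε)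
       (trans (sym (∣-p∣≡∣p∣ (s m - s n))) (cong ∣_∣ (neg-distrib-+ (s m) (- s n))))
       (close m n ≤m ≤n)

eventually-bounded : ∀ {s} → IsCauchy s →
  ∃[ B ] (0ℚ < B × ∃[ N ] (∀ n → N ℕ.≤ n → ∣ s n ∣ ≤ B))
eventually-bounded {s} cs =
  let N , close = cs 1ℚ (positive⁻¹ 1ℚ)
  in 1ℚ + ∣ s N ∣
   , +-mono-<-≤ (positive⁻¹ 1ℚ) (0≤∣p∣ (s N))
   , N
   , λ n ≤n → begin
       ∣ s n ∣                    ≡⟨ cong ∣_∣ (rearrange (s n) (s N)) ⟩
       ∣ (s n - s N) + s N ∣      ≤⟨ ∣p+q∣≤∣p∣+∣q∣ (s n - s N) (s N) ⟩
       ∣ s n - s N ∣ + ∣ s N ∣    ≤⟨ +-monoˡ-≤ ∣ s N ∣ (<⇒≤ (close n N ≤n ℕ.≤-refl)) ⟩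
       1ℚ + ∣ s N ∣               ∎
  where
  open ≤-Reasoning
  rearrange : ∀ a b → a ≡ (a - b) + b
  rearrange = solve 2 (λ a b → a := (a :- b) :+ b) refl
    where open +-*-Solver

scaled : ∀ B ε → 0ℚ < B → 0ℚ < ε → ∃[ δ ] (0ℚ < δ × B * δ ≡ ε)
scaled B ε B>0 ε>0 = 1/B * ε
  , positive⁻¹ (1/B * ε) {{pos*pos⇒pos 1/B {{1/pos⇒pos B}} ε {{positive ε>0}}}}
  , trans (sym (*-assoc B 1/B ε))
      (trans (cong (_* ε) (*-inverseʳ B)) (*-identityˡ ε))
  where
  instance
    B-pos : Positive B
    B-pos = positive B>0
    B-nz : NonZero B
    B-nz = pos⇒nonZero B
  1/B = 1/ B

product-small : ∀ {a b B δ} → 0ℚ < B → ∣ a ∣ ≤ B → ∣ b ∣ < δ → ∣ a * b ∣ < B * δ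
product-small {a} {b} {B} {δ} B>0 a≤B b<δ = begin-strict
  ∣ a * b ∣        ≡⟨ ∣p*q∣≡∣p∣*∣q∣ a b ⟩
  ∣ a ∣ * ∣ b ∣    ≤⟨ *-monoʳ-≤-nonNeg ∣ b ∣ {{nonNegative (0≤∣p∣ b)}} a≤B ⟩
  B * ∣ b ∣        <⟨ *-monoʳ-<-pos B {{positive B>0}} b<δ ⟩
  B * δ            ∎
  where open ≤-Reasoning

*-cauchy : ∀ s t → IsCauchy s → IsCauchy t → IsCauchy (λ n → s n * t n)
*-cauchy s t cs ct ε ε>0 =
  let B , B>0 , K , s≤B = eventually-bounded cs
      C , C>0 , L , t≤C = eventually-bounded ct
      δ , δ>0 , Bδ≡     = scaled B (½ * ε) B>0 (half>0 ε>0)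
      η , η>0 , Cη≡     = scaled C (½ * ε) C>0 (half>0 ε>0)
      M , closeₛ        = cs η η>0
      N , closeₜ        = ct δ δ>0
  in (K ℕ.⊔ L) ℕ.⊔ (M ℕ.⊔ N) , λ m n ≤m ≤n →
    let KL≤m = ℕ.m⊔n≤o⇒m≤o (K ℕ.⊔ L) (M ℕ.⊔ N) ≤m
        MN≤m = ℕ.m⊔n≤o⇒n≤o (K ℕ.⊔ L) (M ℕ.⊔ N) ≤m
        KL≤n = ℕ.m⊔n≤o⇒m≤o (K ℕ.⊔ L) (M ℕ.⊔ N) ≤n
        MN≤n = ℕ.m⊔n≤o⇒n≤o (K ℕ.⊔ L) (M ℕ.⊔ N) ≤n
    in begin-strict
      ∣ s m * t m - s n * t n ∣
        ≡⟨ cong ∣_∣ (rearrange (s m) (t m) (s n) (t n)) ⟩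
      ∣ s m * (t m - t n) + t n * (s m - s n) ∣
        ≤⟨ ∣p+q∣≤∣p∣+∣q∣ (s m * (t m - t n)) (t n * (s m - s n)) ⟩
      ∣ s m * (t m - t n) ∣ + ∣ t n * (s m - s n) ∣
        <⟨ +-mono-<
             (product-small {s m} {t m - t n} B>0
               (s≤B m (ℕ.m⊔n≤o⇒m≤o K L KL≤m))
               (closeₜ m n (ℕ.m⊔n≤o⇒n≤o M N MN≤m) (ℕ.m⊔n≤o⇒n≤o M N MN≤n)))
             (product-small {t n} {s m - s n} C>0
               (t≤C n (ℕ.m⊔n≤o⇒n≤o K L KL≤n))
               (closeₛ m n (ℕ.m⊔n≤o⇒m≤o M N MN≤m) (ℕ.m⊔n≤o⇒m≤o M N MN≤n))) ⟩
      B * δ + C * η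
        ≡⟨ cong₂ _+_ Bδ≡ Cη≡ ⟩
      ½ * ε + ½ * ε
        ≡⟨ half+half ε ⟩
      ε ∎
  where
  open ≤-Reasoning
  rearrange : ∀ a b c d → a * b - c * d ≡ a * (b - d) + d * (a - c)
  rearrange = solve 4 (λ a b c d → a :* b :- c :* d := a :* (b :- d) :+ d :* (a :- c)) refl
    where open +-*-Solver

ℝ-rawRing : RawRing 0ℓ 0ℓ
ℝ-rawRing = record
  { Carrier = ℝ
  ; _≈_     = _≈ᴿ_
  ; _+_     = λ x y → real (λ n → seq x n + seq y n) (+-cauchy (seq x) (seq y) (cauchy x) (cauchy y))
  ; _*_     = λ x y → real (λ n → seq x n * seq y n) (*-cauchy (seq x) (seq y) (cauchy x) (cauchy y))
  ; -_      = λ x → real (λ n → - seq x n) (neg-cauchy (seq x) (cauchy x))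
  ; 0#      = fromℚ 0ℚ
  ; 1#      = fromℚ 1ℚ
  }

evalℝ : ∀ {n} → Poly n → Vec ℝ n → ℝ
evalℝ = Evaluation.eval ℝ-rawRing fromℚ

NonNegativeOnOrthant : ∀ {n} → Poly n → Set
NonNegativeOnOrthant {n} p =
  ∀ (x : Vec ℝ n) → VecAll.All (fromℚ 0ℚ ≤ᴿ_) x → fromℚ 0ℚ ≤ᴿ evalℝ p x

-- The pair refutes, in n variables, the implication
-- "H_μ - H_ν ≥ 0 on the nonnegative orthant ⇒ μ dominates ν".
IsCounterexample : ℕ → Partition → Partition → Set
IsCounterexample n ν μ =
  size ν ≡ size μ × NonNegativeOnOrthant (H n μ -ᴾ H n ν) × ¬ (μ ⪰ ν)

{-# OPTIONS --safe #-}
module Submission where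

-- Write H₄₄ - H₅₂₁ = Σ dᵢ·x^αᵢ·rᵢ² with dᵢ > 0.  Replacing each xⱼ by xⱼ² turns
-- x^α·r(x)² into the square of x^α·r(x₁²,x₂²,x₃²), and on the orthant each summand
-- is visibly nonnegative.  Such an expression, invariant under permutations of the
-- variables, comes from a linear program over squares r² of short r vanishing at
-- (1,1,1), where H₄₄ - H₅₂₁ does.  For the incomparable pairs of size at most 7 it
-- suffices to compare H_ν and H_μ at (1,0,0) and (3,2,2).

open import Defs
open import Algebra.Bundles using (RawRing; CommutativeRing; CommutativeMonoid)
import Algebra.Definitions.RawSemiring as RawSemiringDefinitions
import Algebra.Properties.CommutativeSemigroup as CommutativeSemigroupProperties
import Algebra.Properties.Group as GroupProperties
import Algebra.Properties.Semiring.Exp as SemiringExp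
open import Data.Fin as Fin using (Fin)
import Data.Integer as ℤ
open import Data.List as List using (List; []; _∷_; _++_; upTo)
import Data.List.Properties as List
open import Data.List.Membership.Propositional using (_∈_; _∉_; lose)
open import Data.List.Membership.Propositional.Properties
  using (∈-++⁺ˡ; ∈-++⁺ʳ; ∈-concatMap⁺; ∈-deduplicate⁺; ∈-filter⁺; ∈-upTo⁺)
open import Data.List.Relation.Unary.All as All using (All; []; _∷_; all?)
open import Data.List.Relation.Unary.Any using (Any; here; there; any?)
open import Data.List.Relation.Unary.Linked using (Linked; linked?)
open import Data.Nat as ℕ using (ℕ; zero; suc; _≤_; z≤n; s≤s)
open import Data.Nat.ListAction using (sum)
import Data.Nat.Properties as ℕ
open import Data.Product using (_×_; _,_; proj₂)
open import Data.Rational as ℚ using (ℚ; 0ℚ; 1ℚ; ½; _/_; _+_; _*_; _-_; -_)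
open import Data.Rational.Base using (+-*-rawRing)
import Data.Rational.Properties as ℚ
open import Data.Rational.Solver using (module +-*-Solver)
open import Data.Sum using (_⊎_; [_,_]′)
open import Data.Unit using (tt)
open import Data.Vec as Vec using (Vec; []; _∷_)
import Data.Vec.Properties as Vec
open import Data.Vec.Relation.Unary.All as VecAll using ([]; _∷_)
import Data.Vec.Relation.Unary.All.Properties as VecAll
open import Function using (_∘_; _∘′_)
open import Relation.Nullary using (¬_; Dec; yes; no; contradiction)
open import Relation.Nullary.Decidable using (from-yes; from-no; toWitness; map′; _⊎-dec_)
open import Relation.Binary.PropositionalEquality
  using (_≡_; _≢_; refl; sym; trans; cong; cong₂; subst; module ≡-Reasoning)

private
  variable
    m n k : ℕ

-- Exponent vectors

_≟ᵛ_ : (α β : Vec ℕ n) → Dec (α ≡ β)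
_≟ᵛ_ = Vec.≡-dec ℕ._≟_

infixl 6 _⊕_

_⊕_ : Vec ℕ n → Vec ℕ n → Vec ℕ n
_⊕_ = Vec.zipWith ℕ._+_

⊕-interchange : (α β γ δ : Vec ℕ n) → (α ⊕ β) ⊕ (γ ⊕ δ) ≡ (α ⊕ γ) ⊕ (β ⊕ δ)
⊕-interchange []      []      []      []      = refl
⊕-interchange (a ∷ α) (b ∷ β) (c ∷ γ) (d ∷ δ) =
  cong₂ _∷_ (interchange a b c d) (⊕-interchange α β γ δ)
  where open CommutativeSemigroupProperties ℕ.+-commutativeSemigroup using (interchange)

-- Evaluation of polynomials at rational points

open Evaluation +-*-rawRing (λ c → c) using () renaming (monomial to monomialℚ)
open GroupProperties ℚ.+-0-group using (x∙y⁻¹≈ε⇒x≈y)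
open SemiringExp (CommutativeRing.semiring ℚ.+-*-commutativeRing) using (_^_; ^-homo-*)

monomialℚ-⊕ : (α β : Vec ℕ n) (v : Vec ℚ n) →
              monomialℚ (α ⊕ β) v ≡ monomialℚ α v * monomialℚ β v
monomialℚ-⊕ []      []      []      = refl
monomialℚ-⊕ (a ∷ α) (b ∷ β) (x ∷ v) = trans
  (cong₂ _*_ (^-homo-* x a b) (monomialℚ-⊕ α β v))
  (interchange (x ^ a) (x ^ b) (monomialℚ α v) (monomialℚ β v))
  where
  open CommutativeSemigroupProperties
    (CommutativeMonoid.commutativeSemigroup ℚ.*-1-commutativeMonoid)
    using (interchange)

evalℚ-+ : (p q : Poly n) (v : Vec ℚ n) → evalℚ (p +ᴾ q) v ≡ evalℚ p v + evalℚ q v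
evalℚ-+ []            q v = sym (ℚ.+-identityˡ _)
evalℚ-+ ((c , α) ∷ p) q v =
  trans (cong (c * monomialℚ α v +_) (evalℚ-+ p q v))
    (sym (ℚ.+-assoc (c * monomialℚ α v) (evalℚ p v) (evalℚ q v)))

evalℚ-neg : (p : Poly n) (v : Vec ℚ n) → evalℚ (-ᴾ p) v ≡ - evalℚ p v
evalℚ-neg []            v = refl
evalℚ-neg ((c , α) ∷ p) v = trans
  (cong₂ _+_ (sym (ℚ.neg-distribˡ-* c (monomialℚ α v))) (evalℚ-neg p v))
  (sym (ℚ.neg-distrib-+ (c * monomialℚ α v) (evalℚ p v)))

evalℚ-term* : (c : ℚ) (α : Vec ℕ n) (q : Poly n) (v : Vec ℚ n) →
  evalℚ (List.map (λ (d , β) → c * d , α ⊕ β) q) v ≡ (c * monomialℚ α v) * evalℚ q v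
evalℚ-term* c α []            v = sym (ℚ.*-zeroʳ (c * monomialℚ α v))
evalℚ-term* c α ((d , β) ∷ q) v = trans
  (cong₂ _+_ (cong (c * d *_) (monomialℚ-⊕ α β v)) (evalℚ-term* c α q v))
  (rearrange c d (monomialℚ α v) (monomialℚ β v) (evalℚ q v))
  where
  open +-*-Solver
  rearrange : ∀ c d a b e → (c * d) * (a * b) + (c * a) * e ≡ (c * a) * (d * b + e)
  rearrange = solve 5 (λ c d a b e →
    (c :* d) :* (a :* b) :+ (c :* a) :* e := (c :* a) :* (d :* b :+ e)) refl

evalℚ-* : (p q : Poly n) (v : Vec ℚ n) → evalℚ (p *ᴾ q) v ≡ evalℚ p v * evalℚ q v
evalℚ-* []            q v = sym (ℚ.*-zeroˡ (evalℚ q v))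
evalℚ-* ((c , α) ∷ p) q v = begin
  evalℚ (List.map _ q ++ p *ᴾ q) v
    ≡⟨ evalℚ-+ (List.map _ q) (p *ᴾ q) v ⟩
  evalℚ (List.map _ q) v + evalℚ (p *ᴾ q) v
    ≡⟨ cong₂ _+_ (evalℚ-term* c α q v) (evalℚ-* p q v) ⟩
  (c * monomialℚ α v) * evalℚ q v + evalℚ p v * evalℚ q v
    ≡⟨ ℚ.*-distribʳ-+ (evalℚ q v) (c * monomialℚ α v) (evalℚ p v) ⟨
  (c * monomialℚ α v + evalℚ p v) * evalℚ q v
    ∎
  where open ≡-Reasoning

-- Equality of polynomials

coeff-+ : (p q : Poly n) (α : Vec ℕ n) → coeff (p +ᴾ q) α ≡ coeff p α + coeff q α
coeff-+ []            q α = sym (ℚ.+-identityˡ _)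
coeff-+ ((c , β) ∷ p) q α with β ≟ᵛ α
... | yes _ = trans (cong (c +_) (coeff-+ p q α)) (sym (ℚ.+-assoc c _ _))
... | no  _ = coeff-+ p q α

coeff-neg : (p : Poly n) (α : Vec ℕ n) → coeff (-ᴾ p) α ≡ - coeff p α
coeff-neg []            α = refl
coeff-neg ((c , β) ∷ p) α with β ≟ᵛ α
... | yes _ = trans (cong (- c +_) (coeff-neg p α)) (sym (ℚ.neg-distrib-+ c _))
... | no  _ = coeff-neg p α

without : Vec ℕ n → Poly n → Poly n
without α []            = []
without α ((c , β) ∷ p) with β ≟ᵛ α
... | yes _ = without α p
... | no  _ = (c , β) ∷ without α p

length-without : (α : Vec ℕ n) (p : Poly n) → List.length (without α p) ≤ List.length p
length-without α []            = z≤n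
length-without α ((c , β) ∷ p) with β ≟ᵛ α
... | yes _ = ℕ.m≤n⇒m≤1+n (length-without α p)
... | no  _ = s≤s (length-without α p)

without-head : (c : ℚ) (α : Vec ℕ n) (p : Poly n) → without α ((c , α) ∷ p) ≡ without α p
without-head c α p with α ≟ᵛ α
... | yes _   = refl
... | no  α≢α = contradiction refl α≢α

coeff-without-same : (α : Vec ℕ n) (p : Poly n) → coeff (without α p) α ≡ 0ℚ
coeff-without-same α []            = refl
coeff-without-same α ((c , β) ∷ p) with β ≟ᵛ α
... | yes _   = coeff-without-same α p
-- The term survives in `without α`, so `coeff` compares its exponent with `α` a second time.
... | no  β≢α with β ≟ᵛ α
...   | yes β≡α = contradiction β≡α β≢α
...   | no  _   = coeff-without-same α p

coeff-without-other : {α γ : Vec ℕ n} → α ≢ γ → (p : Poly n) →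
                      coeff (without α p) γ ≡ coeff p γ
coeff-without-other         α≢γ []            = refl
coeff-without-other {α = α} {γ} α≢γ ((c , β) ∷ p) with β ≟ᵛ α
... | yes refl with β ≟ᵛ γ
...   | yes β≡γ = contradiction β≡γ α≢γ
...   | no  _   = coeff-without-other α≢γ p
coeff-without-other {α = α} {γ} α≢γ ((c , β) ∷ p) | no _ with β ≟ᵛ γ
...   | yes _   = cong (c +_) (coeff-without-other α≢γ p)
...   | no  _   = coeff-without-other α≢γ p

-- All terms with exponent `α`, scattered over the list, are collected into one. This is what makes
-- evaluation depend on coefficients rather than on the term list.
evalℚ-without : (α : Vec ℕ n) (p : Poly n) (v : Vec ℚ n) →
  evalℚ p v ≡ coeff p α * monomialℚ α v + evalℚ (without α p) v
evalℚ-without α []            v = sym (trans (ℚ.+-identityʳ (0ℚ * monomialℚ α v)) (ℚ.*-zeroˡ (monomialℚ α v)))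
evalℚ-without α ((c , β) ∷ p) v with β ≟ᵛ α
... | yes refl = trans (cong (c * monomialℚ α v +_) (evalℚ-without α p v))
  (rearrange c (monomialℚ α v) (coeff p α) (evalℚ (without α p) v))
  where
  open +-*-Solver
  rearrange : ∀ c m a e → c * m + (a * m + e) ≡ (c + a) * m + e
  rearrange = solve 4 (λ c m a e → c :* m :+ (a :* m :+ e) := (c :+ a) :* m :+ e) refl
... | no _ = trans (cong (c * monomialℚ β v +_) (evalℚ-without α p v))
  (rearrange (c * monomialℚ β v) (coeff p α * monomialℚ α v) (evalℚ (without α p) v))
  where
  open +-*-Solver
  rearrange : ∀ t a e → t + (a + e) ≡ a + (t + e)
  rearrange = solve 3 (λ t a e → t :+ (a :+ e) := a :+ (t :+ e)) refl

-- The monomial of the first term has total coefficient 0, so all its terms can be deleted without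
-- changing the value or any other coefficient. The result of `without` is not a structural part of
-- `p`; the bound `k` on the length carries the recursion instead.
evalℚ-vanishing : ∀ k (p : Poly n) → List.length p ≤ k → p ≈ᴾ [] →
                  (v : Vec ℚ n) → evalℚ p v ≡ 0ℚ
evalℚ-vanishing k       []                _         p≈0 v = refl
evalℚ-vanishing (suc k) p@((c , α) ∷ p′) (s≤s len) p≈0 v = begin
  evalℚ p v
    ≡⟨ evalℚ-without α p v ⟩
  coeff p α * monomialℚ α v + evalℚ (without α p) v
    ≡⟨ cong₂ (λ a q → a * monomialℚ α v + evalℚ q v) (p≈0 α) (without-head c α p′) ⟩
  0ℚ * monomialℚ α v + evalℚ (without α p′) v
    ≡⟨ cong₂ _+_ (ℚ.*-zeroˡ (monomialℚ α v)) (evalℚ-vanishing k (without α p′) len′ rest≈0 v) ⟩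
  0ℚ
    ∎
  where
  open ≡-Reasoning
  len′ : List.length (without α p′) ≤ k
  len′ = ℕ.≤-trans (length-without α p′) len

  rest≈0 : without α p′ ≈ᴾ []
  rest≈0 γ with α ≟ᵛ γ
  ... | yes refl = coeff-without-same α p′
  ... | no  α≢γ  = begin
    coeff (without α p′) γ    ≡⟨ cong (λ q → coeff q γ) (without-head c α p′) ⟨
    coeff (without α p) γ     ≡⟨ coeff-without-other α≢γ p ⟩
    coeff p γ                 ≡⟨ p≈0 γ ⟩
    0ℚ                        ∎

-- Equal polynomials may differ in the order and repetition of their terms, so no induction along
-- the two lists is available. The difference has only zero coefficients and therefore vanishes
-- everywhere.
evalℚ-cong : (p q : Poly n) → p ≈ᴾ q → (v : Vec ℚ n) → evalℚ p v ≡ evalℚ q v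
evalℚ-cong p q p≈q v = x∙y⁻¹≈ε⇒x≈y (evalℚ p v) (evalℚ q v) (begin
  evalℚ p v - evalℚ q v           ≡⟨ cong (evalℚ p v +_) (evalℚ-neg q v) ⟨
  evalℚ p v + evalℚ (-ᴾ q) v      ≡⟨ evalℚ-+ p (-ᴾ q) v ⟨
  evalℚ (p -ᴾ q) v                ≡⟨ evalℚ-vanishing _ (p -ᴾ q) ℕ.≤-refl p-q≈0 v ⟩
  0ℚ                              ∎)
  where
  open ≡-Reasoning
  p-q≈0 : (p -ᴾ q) ≈ᴾ []
  p-q≈0 α = begin
    coeff (p -ᴾ q) α              ≡⟨ coeff-+ p (-ᴾ q) α ⟩
    coeff p α + coeff (-ᴾ q) α    ≡⟨ cong₂ _+_ (p≈q α) (coeff-neg q α) ⟩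
    coeff q α - coeff q α         ≡⟨ ℚ.+-inverseʳ (coeff q α) ⟩
    0ℚ                            ∎

-- Decidability of polynomial equality

support : Poly n → List (Vec ℕ n)
support p = List.deduplicate _≟ᵛ_ (List.map proj₂ p)

coeff-∉ : (p : Poly n) {α : Vec ℕ n} → α ∉ List.map proj₂ p → coeff p α ≡ 0ℚ
coeff-∉ []            α∉ = refl
coeff-∉ ((c , β) ∷ p) {α} α∉ with β ≟ᵛ α
... | yes β≡α = contradiction (here (sym β≡α)) α∉
... | no  _   = coeff-∉ p (α∉ ∘′ there)

-- Outside the exponents listed in `p` or `q` both coefficients are 0, so finitely many comparisons
-- suffice. Removing duplicates in `support` ensures that each coefficient is compared once.
_≈ᴾ?_ : (p q : Poly n) → Dec (p ≈ᴾ q)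
_≈ᴾ?_ {n} p q = map′ everywhere (λ p≈q → All.universal p≈q _)
  (all? (λ α → coeff p α ℚ.≟ coeff q α) (support (p ++ q)))
  where
  open import Data.List.Membership.DecPropositional (_≟ᵛ_ {n}) using (_∈?_)
  monomials : ∀ p → List (Vec ℕ n)
  monomials = List.map proj₂

  everywhere : All (λ α → coeff p α ≡ coeff q α) (support (p ++ q)) → p ≈ᴾ q
  everywhere agree α with α ∈? monomials (p ++ q)
  ... | yes α∈ = All.lookup agree (∈-deduplicate⁺ _≟ᵛ_ α∈)
  ... | no  α∉ = trans
    (coeff-∉ p (λ α∈p → α∉ (subst (α ∈_) (sym monomials-++) (∈-++⁺ˡ α∈p))))
    (sym (coeff-∉ q (λ α∈q → α∉ (subst (α ∈_) (sym monomials-++) (∈-++⁺ʳ (monomials p) α∈q)))))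
    where
    monomials-++ : monomials (p ++ q) ≡ monomials p ++ monomials q
    monomials-++ = List.map-++ proj₂ p q

-- Substitution of squares for the variables

double : Poly n → Poly n
double = List.map λ (c , α) → c , α ⊕ α

mono : Vec ℕ n → Poly n
mono α = (1ℚ , α) ∷ []

zeros-⊕ : (α : Vec ℕ n) → Vec.replicate n 0 ⊕ α ≡ α
zeros-⊕ = Vec.zipWith-identityˡ ℕ.+-identityˡ

zeros-⊕-zeros : Vec.replicate n 0 ⊕ Vec.replicate n 0 ≡ Vec.replicate n 0
zeros-⊕-zeros = zeros-⊕ _

constᴾ-*-mono : (c : ℚ) (α : Vec ℕ n) → constᴾ c *ᴾ mono α ≡ (c , α) ∷ []
constᴾ-*-mono c α = cong₂ (λ d β → (d , β) ∷ []) (ℚ.*-identityʳ c) (zeros-⊕ α)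

module _ {n : ℕ} where
  open Evaluation (polyRawRing n) constᴾ public using () renaming (monomial to monomialᴾ)
  open RawSemiringDefinitions (RawRing.rawSemiring (polyRawRing n)) public
    using () renaming (_^_ to _^ᴾ_)

  mono-^ : (α : Vec ℕ n) (k : ℕ) → mono α ^ᴾ k ≡ mono (Vec.map (k ℕ.*_) α)
  mono-^ α zero    = cong mono (sym (Vec.map-const α 0))
  mono-^ α (suc k) = trans (cong (mono α *ᴾ_) (mono-^ α k)) (cong mono (α⊕kα α))
    where
    α⊕kα : ∀ {n} (α : Vec ℕ n) → α ⊕ Vec.map (k ℕ.*_) α ≡ Vec.map (suc k ℕ.*_) α
    α⊕kα []      = refl
    α⊕kα (a ∷ α) = cong (_ ∷_) (α⊕kα α)

  -- The linear combination of the vectors `βs` with coefficients `α`, that is, the exponent of the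
  -- monomial obtained by substituting monomials with exponents `βs` into the monomial with exponent
  -- `α`.
  combination : Vec ℕ m → Vec (Vec ℕ n) m → Vec ℕ n
  combination []      []       = Vec.replicate n 0
  combination (k ∷ α) (β ∷ βs) = Vec.map (k ℕ.*_) β ⊕ combination α βs

  monomialᴾ-mono : (α : Vec ℕ m) (βs : Vec (Vec ℕ n) m) →
                   monomialᴾ α (Vec.map mono βs) ≡ mono (combination α βs)
  monomialᴾ-mono []      []       = refl
  monomialᴾ-mono (k ∷ α) (β ∷ βs) = cong₂ _*ᴾ_ (mono-^ β k) (monomialᴾ-mono α βs)

unit : Fin n → Vec ℕ n
unit i = Vec.updateAt (Vec.replicate _ 0) i suc

combination-0∷ : (α : Vec ℕ m) (f : Fin m → Vec ℕ n) →
  combination α (Vec.tabulate λ i → 0 ∷ f i) ≡ 0 ∷ combination α (Vec.tabulate f)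
combination-0∷ []      f = refl
combination-0∷ (k ∷ α) f = trans
  (cong (Vec.map (k ℕ.*_) (0 ∷ f Fin.zero) ⊕_) (combination-0∷ α (f ∘ Fin.suc)))
  (cong (_∷ combination (k ∷ α) (Vec.tabulate f)) (trans (ℕ.+-identityʳ (k ℕ.* 0)) (ℕ.*-zeroʳ k)))

combination-units : (α : Vec ℕ n) →
  combination α (Vec.tabulate λ i → unit i ⊕ unit i) ≡ α ⊕ α
combination-units         []      = refl
combination-units {suc n} (k ∷ α) = trans
  (cong (Vec.map (k ℕ.*_) (2 ∷ 0s ⊕ 0s) ⊕_) (combination-0∷ α (λ i → unit i ⊕ unit i)))
  (cong₂ _∷_ k*2 (trans (cong₂ _⊕_ k*0s (combination-units α)) (zeros-⊕ (α ⊕ α))))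
  where
  0s : Vec ℕ n
  0s = Vec.replicate n 0

  k*2 : k ℕ.* 2 ℕ.+ 0 ≡ k ℕ.+ k
  k*2 = trans (ℕ.+-identityʳ (k ℕ.* 2)) (trans (ℕ.*-comm k 2) (cong (k ℕ.+_) (ℕ.+-identityʳ k)))

  k*0s : Vec.map (k ℕ.*_) (0s ⊕ 0s) ≡ 0s
  k*0s = trans (cong (Vec.map (k ℕ.*_)) zeros-⊕-zeros)
    (trans (Vec.map-replicate (k ℕ.*_) 0 n) (cong (Vec.replicate n) (ℕ.*-zeroʳ k)))

-- Substituting monomials into a monomial yields a single term again, so the equality holds for term
-- lists and not only up to `_≈ᴾ_`.
squareVariables-double : (p : Poly n) → squareVariables p ≡ double p
squareVariables-double         []            = refl
squareVariables-double {n = n} ((c , α) ∷ p) = cong₂ _++_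
  (trans (cong (constᴾ c *ᴾ_) monomial-squares) (constᴾ-*-mono c (α ⊕ α)))
  (squareVariables-double p)
  where
  monomial-squares : monomialᴾ α (Vec.tabulate λ i → var i *ᴾ var i) ≡ mono (α ⊕ α)
  monomial-squares = trans
    (cong (monomialᴾ α) (Vec.tabulate-∘ mono (λ i → unit i ⊕ unit i)))
    (trans (monomialᴾ-mono α _) (cong mono (combination-units α)))

-- Since polynomial multiplication is a product of term lists, this shows both that doubling
-- exponents is multiplicative and that a monomial factor can be pulled out of a square, with no
-- collecting of like terms.
cartesianProductWith-map : ∀ {A B C A′ B′ C′ : Set}
  (_∙_ : A → B → C) (_∙′_ : A′ → B′ → C′) (f : A → A′) (g : B → B′) (h : C → C′) →
  (∀ x y → f x ∙′ g y ≡ h (x ∙ y)) → ∀ xs ys →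
  List.cartesianProductWith _∙′_ (List.map f xs) (List.map g ys) ≡
  List.map h (List.cartesianProductWith _∙_ xs ys)
cartesianProductWith-map _∙_ _∙′_ f g h hom []       ys = refl
cartesianProductWith-map _∙_ _∙′_ f g h hom (x ∷ xs) ys = begin
  List.map (f x ∙′_) (List.map g ys) ++ rest′
    ≡⟨ cong₂ _++_ (trans (sym (List.map-∘ ys)) (trans (List.map-cong (hom x) ys) (List.map-∘ ys)))
                  (cartesianProductWith-map _∙_ _∙′_ f g h hom xs ys) ⟩
  List.map h (List.map (x ∙_) ys) ++ List.map h rest
    ≡⟨ List.map-++ h (List.map (x ∙_) ys) rest ⟨
  List.map h (List.map (x ∙_) ys ++ rest)
    ∎
  where
  open ≡-Reasoning
  rest  = List.cartesianProductWith _∙_ xs ys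
  rest′ = List.cartesianProductWith _∙′_ (List.map f xs) (List.map g ys)

double-* : (p q : Poly n) → double (p *ᴾ q) ≡ double p *ᴾ double q
double-* p q = sym (cartesianProductWith-map _ _ _ _ _
  (λ (c , α) (d , β) → cong (c * d ,_) (⊕-interchange α α β β)) p q)

shift : Vec ℕ n → Poly n → Poly n
shift α = List.map λ (c , β) → c , α ⊕ β

mono-*ᴾ : (α : Vec ℕ n) (p : Poly n) → mono α *ᴾ p ≡ shift α p
mono-*ᴾ α p = trans (List.++-identityʳ _)
  (List.map-cong (λ (c , β) → cong (_, α ⊕ β) (ℚ.*-identityˡ c)) p)

mono-*ᴾ-square : (α : Vec ℕ n) (p : Poly n) →
  (mono α *ᴾ p) *ᴾ (mono α *ᴾ p) ≡ mono (α ⊕ α) *ᴾ (p *ᴾ p)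
mono-*ᴾ-square α p = begin
  (mono α *ᴾ p) *ᴾ (mono α *ᴾ p)    ≡⟨ cong₂ _*ᴾ_ (mono-*ᴾ α p) (mono-*ᴾ α p) ⟩
  shift α p *ᴾ shift α p            ≡⟨ cartesianProductWith-map _ _ _ _ _
                                         (λ (c , β) (d , γ) → cong (c * d ,_) (⊕-interchange α β α γ)) p p ⟩
  shift (α ⊕ α) (p *ᴾ p)            ≡⟨ mono-*ᴾ (α ⊕ α) (p *ᴾ p) ⟨
  mono (α ⊕ α) *ᴾ (p *ᴾ p)          ∎
  where open ≡-Reasoning

halve : Vec ℕ n → Vec ℕ n
halve = Vec.map ℕ.⌊_/2⌋

halve-⊕ : (α : Vec ℕ n) → halve (α ⊕ α) ≡ α
halve-⊕ []      = refl
halve-⊕ (a ∷ α) = cong₂ _∷_ (sym (ℕ.n≡⌊n+n/2⌋ a)) (halve-⊕ α)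

⊕-self-injective : {α β : Vec ℕ n} → α ⊕ α ≡ β ⊕ β → α ≡ β
⊕-self-injective {α = α} {β} eq = trans (sym (halve-⊕ α)) (trans (cong halve eq) (halve-⊕ β))

coeff-double-even : (p : Poly n) (α : Vec ℕ n) → coeff (double p) (α ⊕ α) ≡ coeff p α
coeff-double-even []            α = refl
coeff-double-even ((c , β) ∷ p) α with (β ⊕ β) ≟ᵛ (α ⊕ α) | β ≟ᵛ α
... | yes _  | yes _   = cong (c +_) (coeff-double-even p α)
... | yes eq | no β≢α  = contradiction (⊕-self-injective eq) β≢α
... | no neq | yes β≡α = contradiction (cong₂ _⊕_ β≡α β≡α) neq
... | no _   | no _    = coeff-double-even p α

coeff-double-odd : (p : Poly n) {α : Vec ℕ n} → (∀ β → β ⊕ β ≢ α) → coeff (double p) α ≡ 0ℚ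
coeff-double-odd []                odd = refl
coeff-double-odd ((c , β) ∷ p) {α} odd with (β ⊕ β) ≟ᵛ α
... | yes eq = contradiction eq (odd β)
... | no  _  = coeff-double-odd p odd

-- After doubling, an exponent with an odd entry has coefficient 0, and any other has the
-- coefficient of its half. As `halve` rounds down, comparing `α` with twice `halve α` tells the two
-- cases apart.
double-cong : (p q : Poly n) → p ≈ᴾ q → double p ≈ᴾ double q
double-cong p q p≈q α with (halve α ⊕ halve α) ≟ᵛ α
... | yes even = subst (λ γ → coeff (double p) γ ≡ coeff (double q) γ) even
  (trans (coeff-double-even p (halve α)) (trans (p≈q (halve α)) (sym (coeff-double-even q (halve α)))))
... | no ¬even = trans (coeff-double-odd p odd) (sym (coeff-double-odd q odd))
  where
  odd : ∀ β → β ⊕ β ≢ α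
  odd β refl = ¬even (cong₂ _⊕_ (halve-⊕ β) (halve-⊕ β))

-- Certificates of nonnegativity on the orthant

-- The entry (d , α , r) stands for d·x^α·r².
Certificate : ℕ → ℕ → Set
Certificate n k = Vec (ℚ × Vec ℕ n × Poly n) k

PositiveWeights : Certificate n k → Set
PositiveWeights = VecAll.All λ (d , _) → 0ℚ ℚ.< d

value : Certificate n k → Poly n
value = Vec.foldr′ (λ (d , α , r) s → (constᴾ d *ᴾ (mono α *ᴾ (r *ᴾ r))) +ᴾ s) []

squares : Certificate n k → Vec (ℚ × Poly n) k
squares = Vec.map λ (d , α , r) → d , mono α *ᴾ double r

-- The monomial x^α becomes x^(2α), which is the square of x^α. This is why `squares` doubles the
-- exponents of `r` but leaves `α` as it is.
double-value : (C : Certificate n k) → double (value C) ≡ weightedSquares (squares C)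
double-value []                = refl
double-value ((d , α , r) ∷ C) = begin
  double (constᴾ d *ᴾ (mono α *ᴾ (r *ᴾ r)) ++ value C)
    ≡⟨ List.map-++ _ (constᴾ d *ᴾ (mono α *ᴾ (r *ᴾ r))) (value C) ⟩
  double (constᴾ d *ᴾ (mono α *ᴾ (r *ᴾ r))) ++ double (value C)
    ≡⟨ cong₂ _++_ double-term (double-value C) ⟩
  constᴾ d *ᴾ (q *ᴾ q) ++ weightedSquares (squares C)
    ∎
  where
  open ≡-Reasoning
  q = mono α *ᴾ double r
  double-term : double (constᴾ d *ᴾ (mono α *ᴾ (r *ᴾ r))) ≡ constᴾ d *ᴾ (q *ᴾ q)
  double-term = begin
    double (constᴾ d *ᴾ (mono α *ᴾ (r *ᴾ r)))
      ≡⟨ double-* (constᴾ d) (mono α *ᴾ (r *ᴾ r)) ⟩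
    double (constᴾ d) *ᴾ double (mono α *ᴾ (r *ᴾ r))
      ≡⟨ cong₂ _*ᴾ_ (cong (λ β → (d , β) ∷ []) zeros-⊕-zeros) (double-* (mono α) (r *ᴾ r)) ⟩
    constᴾ d *ᴾ (mono (α ⊕ α) *ᴾ double (r *ᴾ r))
      ≡⟨ cong (λ s → constᴾ d *ᴾ (mono (α ⊕ α) *ᴾ s)) (double-* r r) ⟩
    constᴾ d *ᴾ (mono (α ⊕ α) *ᴾ (double r *ᴾ double r))
      ≡⟨ cong (constᴾ d *ᴾ_) (mono-*ᴾ-square α (double r)) ⟨
    constᴾ d *ᴾ (q *ᴾ q)
      ∎

-- The hypothesis is an identity in the original variables, at half the degree of the sum of squares
-- that it yields.
certificate⇒sumOfSquares : (p : Poly n) (C : Certificate n k) → PositiveWeights C →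
  p ≈ᴾ value C → IsSumOfSquares k (squareVariables p)
certificate⇒sumOfSquares p C d>0 p≈C = squares C , VecAll.map⁺ d>0 , λ α → begin
  coeff (squareVariables p) α               ≡⟨ cong (λ q → coeff q α) (squareVariables-double p) ⟩
  coeff (double p) α                        ≡⟨ double-cong p (value C) p≈C α ⟩
  coeff (double (value C)) α                ≡⟨ cong (λ q → coeff q α) (double-value C) ⟩
  coeff (weightedSquares (squares C)) α     ∎
  where open ≡-Reasoning

-- Nonnegative reals

open RawRing ℝ-rawRing using () renaming (_+_ to _+ᴿ_; _*_ to _*ᴿ_; 0# to 0ℝ; 1# to 1ℝ)

open Evaluation ℝ-rawRing fromℚ using () renaming (monomial to monomialℝ)
open RawSemiringDefinitions (RawRing.rawSemiring ℝ-rawRing) using () renaming (_^_ to _^ᴿ_)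

at : ℕ → Vec ℝ n → Vec ℚ n
at i = Vec.map λ x → seq x i

seq-^ : (x : ℝ) (k i : ℕ) → seq (x ^ᴿ k) i ≡ seq x i ^ k
seq-^ x zero    i = refl
seq-^ x (suc k) i = cong (seq x i *_) (seq-^ x k i)

seq-monomialℝ : (α : Vec ℕ n) (x : Vec ℝ n) (i : ℕ) →
                seq (monomialℝ α x) i ≡ monomialℚ α (at i x)
seq-monomialℝ []      []      i = refl
seq-monomialℝ (k ∷ α) (y ∷ x) i = cong₂ _*_ (seq-^ y k i) (seq-monomialℝ α x i)

-- Arithmetic on `ℝ` acts termwise on sequences. Identities between rational values therefore carry
-- over to every approximation, and no ring laws for `ℝ` have to be established.
seq-evalℝ : (p : Poly n) (x : Vec ℝ n) (i : ℕ) → seq (evalℝ p x) i ≡ evalℚ p (at i x)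
seq-evalℝ []            x i = refl
seq-evalℝ ((c , α) ∷ p) x i = cong₂ _+_ (cong (c *_) (seq-monomialℝ α x i)) (seq-evalℝ p x i)

infix 4 0≤_

0≤_ : ℝ → Set
0≤ x = fromℚ 0ℚ ≤ᴿ x

0≤-resp : {x y : ℝ} → (∀ i → seq x i ≡ seq y i) → 0≤ x → 0≤ y
0≤-resp x≡y 0≤x ε ε>0 =
  let N , bound = 0≤x ε ε>0
  in N , λ i N≤i → subst (λ a → 0ℚ ℚ.≤ a + ε) (x≡y i) (bound i N≤i)

pointwise-0≤ : {x : ℝ} → (∀ i → 0ℚ ℚ.≤ seq x i) → 0≤ x
pointwise-0≤ 0≤x ε ε>0 = 0 , λ i _ → ℚ.+-mono-≤ (0≤x i) (ℚ.<⇒≤ ε>0)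

0≤-+ : {x y : ℝ} → 0≤ x → 0≤ y → 0≤ (x +ᴿ y)
0≤-+ {x} {y} 0≤x 0≤y ε ε>0 =
  let M , boundₓ = 0≤x (½ * ε) (half>0 ε>0)
      N , bound  = 0≤y (½ * ε) (half>0 ε>0)
  in M ℕ.⊔ N , λ i ≤i → begin
    0ℚ                                         ≤⟨ ℚ.+-mono-≤ (boundₓ i (ℕ.m⊔n≤o⇒m≤o M N ≤i))
                                                             (bound i (ℕ.m⊔n≤o⇒n≤o M N ≤i)) ⟩
    (seq x i + ½ * ε) + (seq y i + ½ * ε)      ≡⟨ interchange (seq x i) (½ * ε) (seq y i) (½ * ε) ⟩
    (seq x i + seq y i) + (½ * ε + ½ * ε)      ≡⟨ cong (seq x i + seq y i +_) (half+half ε) ⟩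
    (seq x i + seq y i) + ε                    ∎
  where
  open ℚ.≤-Reasoning
  open CommutativeSemigroupProperties
    (CommutativeMonoid.commutativeSemigroup ℚ.+-0-commutativeMonoid) using (interchange)

0≤p*q : ∀ {p q} → 0ℚ ℚ.≤ p → 0ℚ ℚ.≤ q → 0ℚ ℚ.≤ p * q
0≤p*q {p} {q} 0≤p 0≤q = subst (ℚ._≤ p * q) (ℚ.*-zeroʳ p)
  (ℚ.*-monoˡ-≤-nonNeg p {{ℚ.nonNegative 0≤p}} 0≤q)

0≤p*q′ : ∀ {p q} → p ℚ.≤ 0ℚ → q ℚ.≤ 0ℚ → 0ℚ ℚ.≤ p * q
0≤p*q′ {p} {q} p≤0 q≤0 = subst (ℚ._≤ p * q) (ℚ.*-zeroʳ p)
  (ℚ.*-monoˡ-≤-nonPos p {{ℚ.nonPositive p≤0}} q≤0)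

0≤p*p : ∀ p → 0ℚ ℚ.≤ p * p
0≤p*p p = [ (λ 0≤p → 0≤p*q 0≤p 0≤p) , (λ p≤0 → 0≤p*q′ p≤0 p≤0) ]′ (ℚ.≤-total 0ℚ p)

0≤p*q+ε : ∀ {p q B δ ε} → 0ℚ ℚ.≤ p → p ℚ.≤ B → 0ℚ ℚ.< δ → B * δ ≡ ε →
          0ℚ ℚ.≤ q + δ → 0ℚ ℚ.≤ p * q + ε
0≤p*q+ε {p} {q} {B} {δ} {ε} 0≤p p≤B δ>0 Bδ≡ε 0≤q+δ = begin
  0ℚ              ≤⟨ 0≤p*q 0≤p 0≤q+δ ⟩
  p * (q + δ)     ≡⟨ ℚ.*-distribˡ-+ p q δ ⟩
  p * q + p * δ   ≤⟨ ℚ.+-monoʳ-≤ (p * q) (ℚ.*-monoʳ-≤-nonNeg δ {{ℚ.nonNegative (ℚ.<⇒≤ δ>0)}} p≤B) ⟩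
  p * q + B * δ   ≡⟨ cong (p * q +_) Bδ≡ε ⟩
  p * q + ε       ∎
  where open ℚ.≤-Reasoning

p≤∣p∣ : ∀ p → p ℚ.≤ ℚ.∣ p ∣
p≤∣p∣ p = [ (λ 0≤p → ℚ.≤-reflexive (sym (ℚ.0≤p⇒∣p∣≡p 0≤p)))
          , (λ p≤0 → ℚ.≤-trans p≤0 (ℚ.0≤∣p∣ p)) ]′ (ℚ.≤-total 0ℚ p)

-- Approximations of a nonnegative real may be negative, so the signs of the terms `a` and `b` are
-- distinguished. If 0 ≤ a ≤ B and b ≥ -δ, then ab ≥ -Bδ = -ε; the case b ≥ 0 is symmetric, with `C`
-- and `η`; and two nonpositive terms have a nonnegative product. Hence the precision asked of each
-- factor is scaled by the bound on the other.
0≤-* : {x y : ℝ} → 0≤ x → 0≤ y → 0≤ (x *ᴿ y)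
0≤-* {x} {y} 0≤x 0≤y ε ε>0 =
  let B , B>0 , K , x≤B = eventually-bounded (cauchy x)
      C , C>0 , L , y≤C = eventually-bounded (cauchy y)
      δ , δ>0 , Bδ≡ε    = scaled B ε B>0 ε>0
      η , η>0 , Cη≡ε    = scaled C ε C>0 ε>0
      M , boundₓ        = 0≤x η η>0
      N , bound         = 0≤y δ δ>0
  in (K ℕ.⊔ L) ℕ.⊔ (M ℕ.⊔ N) , λ i ≤i →
    let KL≤i = ℕ.m⊔n≤o⇒m≤o (K ℕ.⊔ L) (M ℕ.⊔ N) ≤i
        MN≤i = ℕ.m⊔n≤o⇒n≤o (K ℕ.⊔ L) (M ℕ.⊔ N) ≤i
        a    = seq x i
        b    = seq y i
        a≤B  = ℚ.≤-trans (p≤∣p∣ a) (x≤B i (ℕ.m⊔n≤o⇒m≤o K L KL≤i))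
        b≤C  = ℚ.≤-trans (p≤∣p∣ b) (y≤C i (ℕ.m⊔n≤o⇒n≤o K L KL≤i))
        -η≤a = boundₓ i (ℕ.m⊔n≤o⇒m≤o M N MN≤i)
        -δ≤b = bound i (ℕ.m⊔n≤o⇒n≤o M N MN≤i)
    in [ (λ 0≤a → 0≤p*q+ε {a} {b} 0≤a a≤B δ>0 Bδ≡ε -δ≤b)
       , (λ a≤0 →
           [ (λ 0≤b → subst (λ c → 0ℚ ℚ.≤ c + ε) (ℚ.*-comm b a)
                        (0≤p*q+ε {b} {a} 0≤b b≤C η>0 Cη≡ε -η≤a))
           , (λ b≤0 → ℚ.+-mono-≤ (0≤p*q′ a≤0 b≤0) (ℚ.<⇒≤ ε>0))
           ]′ (ℚ.≤-total 0ℚ b))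
       ]′ (ℚ.≤-total 0ℚ a)

0≤-^ : {x : ℝ} → 0≤ x → ∀ k → 0≤ (x ^ᴿ k)
0≤-^     0≤x zero    = pointwise-0≤ {1ℝ} λ _ → ℚ.<⇒≤ (ℚ.positive⁻¹ 1ℚ)
0≤-^ {x} 0≤x (suc k) = 0≤-* {x} {x ^ᴿ k} 0≤x (0≤-^ {x} 0≤x k)

0≤-monomialℝ : (α : Vec ℕ n) (x : Vec ℝ n) → VecAll.All 0≤_ x → 0≤ monomialℝ α x
0≤-monomialℝ []      []      []          = pointwise-0≤ {1ℝ} λ _ → ℚ.<⇒≤ (ℚ.positive⁻¹ 1ℚ)
0≤-monomialℝ (k ∷ α) (y ∷ x) (0≤y ∷ 0≤x) =
  0≤-* {y ^ᴿ k} {monomialℝ α x} (0≤-^ {y} 0≤y k) (0≤-monomialℝ α x 0≤x)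

-- The factors of each summand are evaluated separately in `ℝ`, so that nonnegativity can be
-- assembled factor by factor; `seq-valueℝ` relates the result to the polynomial `value C`.
valueℝ : Certificate n k → Vec ℝ n → ℝ
valueℝ C x = Vec.foldr′
  (λ (d , α , r) s → (fromℚ d *ᴿ (monomialℝ α x *ᴿ (evalℝ r x *ᴿ evalℝ r x))) +ᴿ s) 0ℝ C

0≤-valueℝ : (C : Certificate n k) → PositiveWeights C →
            (x : Vec ℝ n) → VecAll.All 0≤_ x → 0≤ valueℝ C x
0≤-valueℝ []                []          x 0≤x = pointwise-0≤ {0ℝ} λ _ → ℚ.≤-refl
0≤-valueℝ ((d , α , r) ∷ C) (d>0 ∷ C>0) x 0≤x =
  0≤-+ {fromℚ d *ᴿ (M *ᴿ (R *ᴿ R))} {valueℝ C x}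
    (0≤-* {fromℚ d} {M *ᴿ (R *ᴿ R)} (pointwise-0≤ {fromℚ d} λ _ → ℚ.<⇒≤ d>0)
      (0≤-* {M} {R *ᴿ R} (0≤-monomialℝ α x 0≤x)
        -- Every approximation of the square is itself a rational square, whatever the sign of `R`.
        (pointwise-0≤ {R *ᴿ R} λ i → 0≤p*p (seq R i))))
    (0≤-valueℝ C C>0 x 0≤x)
  where
  M = monomialℝ α x
  R = evalℝ r x

evalℚ-constᴾ : (c : ℚ) (v : Vec ℚ n) → evalℚ (constᴾ c) v ≡ c
evalℚ-constᴾ c v = trans (ℚ.+-identityʳ _) (trans (cong (c *_) (monomialℚ-0 v)) (ℚ.*-identityʳ c))
  where
  monomialℚ-0 : (v : Vec ℚ n) → monomialℚ (Vec.replicate n 0) v ≡ 1ℚ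
  monomialℚ-0 []      = refl
  monomialℚ-0 (y ∷ v) = trans (ℚ.*-identityˡ _) (monomialℚ-0 v)

evalℚ-mono : (α : Vec ℕ n) (v : Vec ℚ n) → evalℚ (mono α) v ≡ monomialℚ α v
evalℚ-mono α v = trans (ℚ.+-identityʳ _) (ℚ.*-identityˡ _)

seq-valueℝ : (C : Certificate n k) (x : Vec ℝ n) (i : ℕ) →
             seq (valueℝ C x) i ≡ evalℚ (value C) (at i x)
seq-valueℝ []                x i = refl
seq-valueℝ ((d , α , r) ∷ C) x i = sym (begin
  evalℚ (constᴾ d *ᴾ (mono α *ᴾ (r *ᴾ r)) +ᴾ value C) v
    ≡⟨ evalℚ-+ (constᴾ d *ᴾ (mono α *ᴾ (r *ᴾ r))) (value C) v ⟩
  evalℚ (constᴾ d *ᴾ (mono α *ᴾ (r *ᴾ r))) v + evalℚ (value C) v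
    ≡⟨ cong₂ _+_ eval-term (sym (seq-valueℝ C x i)) ⟩
  d * (seq (monomialℝ α x) i * (seq R i * seq R i)) + seq (valueℝ C x) i
    ∎)
  where
  open ≡-Reasoning
  v = at i x
  R = evalℝ r x
  eval-R : evalℚ r v ≡ seq R i
  eval-R = sym (seq-evalℝ r x i)
  eval-term : evalℚ (constᴾ d *ᴾ (mono α *ᴾ (r *ᴾ r))) v ≡
              d * (seq (monomialℝ α x) i * (seq R i * seq R i))
  eval-term = begin
    evalℚ (constᴾ d *ᴾ (mono α *ᴾ (r *ᴾ r))) v
      ≡⟨ evalℚ-* (constᴾ d) (mono α *ᴾ (r *ᴾ r)) v ⟩
    evalℚ (constᴾ d) v * evalℚ (mono α *ᴾ (r *ᴾ r)) v
      ≡⟨ cong₂ _*_ (evalℚ-constᴾ d v) (evalℚ-* (mono α) (r *ᴾ r) v) ⟩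
    d * (evalℚ (mono α) v * evalℚ (r *ᴾ r) v)
      ≡⟨ cong (d *_) (cong₂ _*_ (trans (evalℚ-mono α v) (sym (seq-monomialℝ α x i)))
                                (trans (evalℚ-* r r v) (cong₂ _*_ eval-R eval-R))) ⟩
    d * (seq (monomialℝ α x) i * (seq R i * seq R i))
      ∎

-- The approximations of a point of the orthant may lie outside it, so `p` need not be nonnegative
-- at them. The identity `p ≈ᴾ value C`, however, holds at all rational points, which makes the two
-- sequences agree term by term.
certificate⇒nonNegative : (p : Poly n) (C : Certificate n k) → PositiveWeights C →
  p ≈ᴾ value C → NonNegativeOnOrthant p
certificate⇒nonNegative p C C>0 p≈C x 0≤x =
  0≤-resp {valueℝ C x} {evalℝ p x}
    (λ i → trans (seq-valueℝ C x i)
             (sym (trans (seq-evalℝ p x i) (evalℚ-cong p (value C) p≈C (at i x)))))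
    (0≤-valueℝ C C>0 x 0≤x)

nonNegative-at-rationals : (p : Poly n) → NonNegativeOnOrthant p →
  (v : Vec ℚ n) → VecAll.All (0ℚ ℚ.≤_) v → ¬ (evalℚ p v ℚ.< 0ℚ)
nonNegative-at-rationals {n = n} p p≥0 v v≥0 e<0 =
  -- The value at the embedded point is the constant sequence `e`. With ε = -e/2, nonnegativity
  -- would give 0 ≤ e + ε = e/2, contradicting e < 0.
  let N , bound = p≥0 x x≥0 (½ * - e) (half>0 -e>0)
  in ℚ.<-irrefl refl (ℚ.≤-<-trans
       (subst (λ a → 0ℚ ℚ.≤ a + ½ * - e) seq≡e (bound N ℕ.≤-refl)) small)
  where
  e = evalℚ p v
  x = Vec.map fromℚ v

  x≥0 : VecAll.All 0≤_ x
  x≥0 = VecAll.map⁺ (VecAll.map (λ {a} a≥0 → pointwise-0≤ {fromℚ a} λ _ → a≥0) v≥0)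

  seq≡e : ∀ {i} → seq (evalℝ p x) i ≡ e
  seq≡e {i} = trans (seq-evalℝ p x i)
    (cong (evalℚ p) (trans (sym (Vec.map-∘ (λ y → seq y i) fromℚ v)) (Vec.map-id v)))

  -e>0 : 0ℚ ℚ.< - e
  -e>0 = ℚ.neg-antimono-< e<0

  small : e + ½ * - e ℚ.< 0ℚ
  small = begin-strict
    e + ½ * - e                 ≡⟨ ℚ.+-identityʳ (e + ½ * - e) ⟨
    (e + ½ * - e) + 0ℚ          <⟨ ℚ.+-monoʳ-< (e + ½ * - e) (half>0 -e>0) ⟩
    (e + ½ * - e) + ½ * - e     ≡⟨ ℚ.+-assoc e (½ * - e) (½ * - e) ⟩
    e + (½ * - e + ½ * - e)     ≡⟨ cong (e +_) (half+half (- e)) ⟩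
    e - e                       ≡⟨ ℚ.+-inverseʳ e ⟩
    0ℚ                          ∎
    where open ℚ.≤-Reasoning

-- The certificate for H₄₄ - H₅₂₁

-- The expression is symmetric, and every summand is fixed by some transposition of
-- the variables, so that its orbit consists of three rotations.
rotate : ℚ × Vec ℕ 3 × Poly 3 → ℚ × Vec ℕ 3 × Poly 3
rotate (d , α , r) = d , cycle α , List.map (λ (c , β) → c , cycle β) r
  where
  cycle : Vec ℕ 3 → Vec ℕ 3
  cycle (i ∷ j ∷ k ∷ []) = k ∷ i ∷ j ∷ []

rotations : Certificate 3 k → Certificate 3 (k ℕ.+ (k ℕ.+ k))
rotations C = C Vec.++ Vec.map rotate C Vec.++ Vec.map (rotate ∘ rotate) C

plus minus : ℕ → ℕ → ℕ → ℚ × Vec ℕ 3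
plus  i j k = 1ℚ   , i ∷ j ∷ k ∷ []
minus i j k = - 1ℚ , i ∷ j ∷ k ∷ []

-- As h₄₄(1,1,1) = 15² = 225 and h₅₂₁(1,1,1) = 21·6·3 = 378 have least common multiple 9450, the
-- difference is (42·h₄₄ - 25·h₅₂₁)/9450. Its coefficient 17/9450 at x₁⁸ comes only from the first
-- generator, in two of its three rotations, whence the weight 17/18900. In each `r` the signs add
-- up to 0, so `r` vanishes at (1,1,1).
generators : Certificate 3 7
generators =
    (ℤ.+ 17 / 18900  , 0 ∷ 0 ∷ 0 ∷ [] , plus 0 4 0 ∷ plus 0 0 4 ∷ minus 1 1 2 ∷ minus 1 2 1 ∷ [])
  ∷ (ℤ.+ 8 / 9450    , 0 ∷ 1 ∷ 1 ∷ [] , plus 3 0 0 ∷ plus 1 1 1 ∷ minus 0 3 0 ∷ minus 0 0 3 ∷ [])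
  ∷ (ℤ.+ 3 / 18900   , 0 ∷ 0 ∷ 0 ∷ [] , plus 0 2 2 ∷ minus 2 1 1 ∷ [])
  ∷ (ℤ.+ 12 / 9450   , 0 ∷ 1 ∷ 1 ∷ [] , plus 0 2 1 ∷ minus 0 1 2 ∷ plus 1 0 2 ∷ minus 1 2 0 ∷ [])
  ∷ (ℤ.+ 1 / 9450    , 0 ∷ 1 ∷ 1 ∷ [] , plus 0 3 0 ∷ minus 0 2 1 ∷ plus 0 1 2 ∷ minus 0 0 3 ∷ [])
  ∷ (ℤ.+ 3 / 18900   , 0 ∷ 0 ∷ 0 ∷ [] , plus 3 1 0 ∷ minus 3 0 1 ∷ plus 2 2 0 ∷ minus 0 2 2
                                         ∷ plus 1 0 3 ∷ minus 0 1 3 ∷ [])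
  ∷ (ℤ.+ 107 / 37800 , 0 ∷ 0 ∷ 0 ∷ [] , plus 2 0 2 ∷ minus 0 2 2 ∷ [])
  ∷ []

splitTail : Certificate n (suc k) → Certificate n (suc (k ℕ.+ k))
splitTail (t ∷ ts) = t ∷ halves Vec.++ halves
  where
  halves = Vec.map (λ (d , α , r) → ½ * d , α , r) ts

-- The rotations of the generators give 21 squares; splitting all but the first
-- as d·q² = (d/2)·q² + (d/2)·q² brings their number to 41.
certificate : Certificate 3 41
certificate = splitTail (rotations generators)

H44-H521 : Poly 3
H44-H521 = H 3 p44 -ᴾ H 3 p521

certificate-positive : PositiveWeights certificate
certificate-positive = from-yes (VecAll.all? (λ (d , _) → 0ℚ ℚ.<? d) certificate)

-- Both sides are homogeneous of degree 8, so the computation compares the coefficients of the 45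
-- monomials of that degree.
certificate-correct : H44-H521 ≈ᴾ value certificate
certificate-correct = toWitness {a? = H44-H521 ≈ᴾ? value certificate} tt

-- Partitions of size at most 7

grow : List ℕ → List (List ℕ)
grow []      = (1 ∷ []) ∷ []
grow (a ∷ l) = (1 ∷ a ∷ l) ∷ (suc a ∷ l) ∷ []

compositions : ℕ → List (List ℕ)
compositions zero    = [] ∷ []
compositions (suc n) = List.concatMap grow (compositions n)

-- A nonempty composition loses one unit by dropping a first part 1 or lowering a larger first part;
-- `grow` inverts both moves.
∈-compositions : (l : List ℕ) → All (0 ℕ.<_) l → l ∈ compositions (sum l)
∈-compositions []                []        = here refl
∈-compositions (suc zero ∷ l)    (_ ∷ l>0) =
  ∈-concatMap⁺ grow (lose (∈-compositions l l>0) (1∷-∈-grow l))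
  where
  1∷-∈-grow : ∀ l → (1 ∷ l) ∈ grow l
  1∷-∈-grow []      = here refl
  1∷-∈-grow (_ ∷ _) = here refl
∈-compositions (suc (suc a) ∷ l) (_ ∷ l>0) =
  ∈-concatMap⁺ grow (lose (∈-compositions (suc a ∷ l) (s≤s z≤n ∷ l>0)) (there (here refl)))

nonincreasing? : (l : List ℕ) → Dec (Linked ℕ._≥_ l)
nonincreasing? = linked? ℕ._≥?_

partitions : ℕ → List (List ℕ)
partitions n = List.filter nonincreasing? (compositions n)

∈-partitions : (ν : Partition) → parts ν ∈ partitions (size ν)
∈-partitions ν = ∈-filter⁺ nonincreasing?
  (∈-compositions (parts ν) (positiveParts ν)) (nonincreasing ν)

length≤size : (ν : Partition) → List.length (parts ν) ≤ size ν
length≤size ν = length≤sum (positiveParts ν)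
  where
  length≤sum : ∀ {l} → All (0 ℕ.<_) l → List.length l ≤ sum l
  length≤sum []          = z≤n
  length≤sum (a>0 ∷ l>0) = ℕ.+-mono-≤ a>0 (length≤sum l>0)

-- Dominance as a finite condition

DominatesUpTo : ℕ → List ℕ → List ℕ → Set
DominatesUpTo n l l′ = All (λ k → sum (List.take k l′) ≤ sum (List.take k l)) (upTo n)

-- Parts are positive, so a partition has at most as many parts as its size. From `k = size μ` on,
-- both partial sums are complete and equal; hence `upTo`, which stops just before that value,
-- suffices.
dominatesUpTo⇒⪰ : (μ ν : Partition) → size ν ≡ size μ →
  DominatesUpTo (size μ) (parts μ) (parts ν) → μ ⪰ ν
dominatesUpTo⇒⪰ μ ν |ν|≡|μ| dom k with k ℕ.<? size μ
... | yes k<|μ| = All.lookup dom (∈-upTo⁺ k<|μ|)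
... | no  k≮|μ| = ℕ.≤-reflexive (begin
  sum (List.take k (parts ν))    ≡⟨ cong sum (List.take-all k (parts ν) (ℕ.≤-trans (length≤size ν) |ν|≤k)) ⟩
  size ν                         ≡⟨ |ν|≡|μ| ⟩
  size μ                         ≡⟨ cong sum (List.take-all k (parts μ) (ℕ.≤-trans (length≤size μ) |μ|≤k)) ⟨
  sum (List.take k (parts μ))    ∎)
  where
  open ≡-Reasoning
  |μ|≤k : size μ ≤ k
  |μ|≤k = ℕ.≮⇒≥ k≮|μ|
  |ν|≤k : size ν ≤ k
  |ν|≤k = subst (_≤ k) (sym |ν|≡|μ|) |μ|≤k

-- Comparison at rational test points

hAt : Vec ℚ n → List ℕ → ℚ
hAt {n} v = List.foldr (λ d a → evalℚ (hᵈ n d) v * a) 1ℚ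

HAt : Vec ℚ n → List ℕ → ℚ
HAt {n} v l = recip (hAt (Vec.replicate n 1ℚ) l) * hAt v l

-- Evaluation is multiplicative. Replacing the expanded product by the product of the values of its
-- factors keeps the finite check below small.
evalℚ-h : ∀ n ν (v : Vec ℚ n) → evalℚ (h n ν) v ≡ hAt v (parts ν)
evalℚ-h n ν v = go (parts ν)
  where
  go : ∀ l → evalℚ (List.foldr (λ d p → hᵈ n d *ᴾ p) (constᴾ 1ℚ) l) v ≡ hAt v l
  go []      = evalℚ-constᴾ 1ℚ v
  go (d ∷ l) = trans (evalℚ-* (hᵈ n d) (List.foldr _ _ l) v) (cong (evalℚ (hᵈ n d) v *_) (go l))

evalℚ-H : ∀ n ν (v : Vec ℚ n) → evalℚ (H n ν) v ≡ HAt v (parts ν)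
evalℚ-H n ν v = trans (evalℚ-* (constᴾ c) (h n ν) v) (cong₂ _*_
  (trans (evalℚ-constᴾ c v) (cong recip (evalℚ-h n ν (Vec.replicate n 1ℚ))))
  (evalℚ-h n ν v))
  where c = recip (evalℚ (h n ν) (Vec.replicate n 1ℚ))

-- At (1,0,0) every h_d equals 1, so H_ν takes the value 1/h_ν(1,1,1) there. One point can refute
-- only one of the two inequalities between H_μ and H_ν; for each incomparable pair in range,
-- (3,2,2) refutes the one that (1,0,0) does not.
testPoints : List (Vec ℚ 3)
testPoints = (1ℚ ∷ 0ℚ ∷ 0ℚ ∷ []) ∷ (ℤ.+ 3 / 1 ∷ ℤ.+ 2 / 1 ∷ ℤ.+ 2 / 1 ∷ []) ∷ []

testPoints-nonNegative : All (VecAll.All (0ℚ ℚ.≤_)) testPoints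
testPoints-nonNegative = from-yes (all? (VecAll.all? (0ℚ ℚ.≤?_)) testPoints)

-- Here `l` stands for μ and `l′` for ν. The last alternative refutes H_μ - H_ν ≥ 0 only, so the
-- opposite difference is treated by the pair in reversed order.
Settled : ℕ → List ℕ → List ℕ → Set
Settled n l l′ =
    DominatesUpTo n l l′
  ⊎ DominatesUpTo n l′ l
  ⊎ Any (λ v → HAt v l ℚ.< HAt v l′) testPoints

settled? : ∀ n l l′ → Dec (Settled n l l′)
settled? n l l′ = all? (λ _ → _ ℕ.≤? _) (upTo n)
  ⊎-dec all? (λ _ → _ ℕ.≤? _) (upTo n)
  ⊎-dec any? (λ v → HAt v l ℚ.<? HAt v l′) testPoints

PairwiseSettled : ℕ → List (List ℕ) → Set
PairwiseSettled n ls = All (λ l → All (Settled n l) ls) ls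

pairwiseSettled? : ∀ n ls → Dec (PairwiseSettled n ls)
pairwiseSettled? n ls = all? (λ l → all? (settled? n l) ls) ls

settled : All (λ n → PairwiseSettled n (partitions n)) (upTo 8)
settled = toWitness {a? = all? (λ n → pairwiseSettled? n (partitions n)) (upTo 8)} tt

negative-at-testPoint : (ν μ : Partition) →
  Any (λ v → HAt v (parts μ) ℚ.< HAt v (parts ν)) testPoints →
  ¬ NonNegativeOnOrthant (H 3 μ -ᴾ H 3 ν)
negative-at-testPoint ν μ negative H≥0 =
  let v≥0 , Hμ<Hν = All.lookupAny testPoints-nonNegative negative
  in nonNegative-at-rationals (H 3 μ -ᴾ H 3 ν) H≥0 _ v≥0 (difference<0 _ Hμ<Hν)
  where
  difference<0 : ∀ v → HAt v (parts μ) ℚ.< HAt v (parts ν) → evalℚ (H 3 μ -ᴾ H 3 ν) v ℚ.< 0ℚ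
  difference<0 v Hμ<Hν = begin-strict
    evalℚ (H 3 μ -ᴾ H 3 ν) v                  ≡⟨ evalℚ-+ (H 3 μ) (-ᴾ (H 3 ν)) v ⟩
    evalℚ (H 3 μ) v + evalℚ (-ᴾ (H 3 ν)) v    ≡⟨ cong₂ _+_ (evalℚ-H 3 μ v)
                                                  (trans (evalℚ-neg (H 3 ν) v) (cong -_ (evalℚ-H 3 ν v))) ⟩
    HAt v (parts μ) - HAt v (parts ν)         <⟨ ℚ.+-monoˡ-< (- HAt v (parts ν)) Hμ<Hν ⟩
    HAt v (parts ν) - HAt v (parts ν)         ≡⟨ ℚ.+-inverseʳ (HAt v (parts ν)) ⟩
    0ℚ                                        ∎
    where open ℚ.≤-Reasoning

degree-minimal : (ν μ : Partition) → size ν ≡ size μ → size μ ≤ 7 →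
  Incomparable ν μ → ¬ NonNegativeOnOrthant (H 3 μ -ᴾ H 3 ν)
degree-minimal ν μ |ν|≡|μ| |μ|≤7 (μ⋡ν , ν⋡μ) =
  [ (λ dom → contradiction (dominatesUpTo⇒⪰ μ ν |ν|≡|μ| dom) μ⋡ν)
  , [ (λ dom → contradiction
        (dominatesUpTo⇒⪰ ν μ (sym |ν|≡|μ|)
          (subst (λ n → DominatesUpTo n (parts ν) (parts μ)) (sym |ν|≡|μ|) dom)) ν⋡μ)
    , negative-at-testPoint ν μ
    ]′
  -- The table `upTo 8` covers the sizes 0 to 7, so `s≤s` turns the bound `size μ ≤ 7` into
  -- membership. The first partition looked up is μ, as `Settled` requires.
  ]′ (All.lookup (All.lookup (All.lookup settled (∈-upTo⁺ (s≤s |μ|≤7))) (∈-partitions μ)) ν∈)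
  where
  ν∈ : parts ν ∈ partitions (size μ)
  ν∈ = subst (λ n → parts ν ∈ partitions n) |ν|≡|μ| (∈-partitions ν)

-- Incomparability of (4,4) and (5,2,1), and the conclusion

p44⋡p521 : ¬ (p44 ⪰ p521)
p44⋡p521 dom = from-no (5 ℕ.≤? 4) (dom 1)

p521⋡p44 : ¬ (p521 ⪰ p44)
-- At `k = 2` the partial sums are 4 + 4 = 8 and 5 + 2 = 7.
p521⋡p44 dom = from-no (8 ℕ.≤? 7) (dom 2)

H44-H521≥0 : NonNegativeOnOrthant H44-H521
H44-H521≥0 = certificate⇒nonNegative H44-H521 certificate certificate-positive certificate-correct

theorem1p2 : IsSumOfSquares 41 (squareVariables (H 3 p44 -ᴾ H 3 p521))
    × NonNegativeOnOrthant (H 3 p44 -ᴾ H 3 p521)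
    × Incomparable p44 p521
    × IsCounterexample 3 p521 p44
    × ((ν μ : Partition) → size ν ≡ size μ → size μ ≤ 7 →
    Incomparable ν μ → ¬ NonNegativeOnOrthant (H 3 μ -ᴾ H 3 ν))
theorem1p2 =
    certificate⇒sumOfSquares H44-H521 certificate certificate-positive certificate-correct
  , H44-H521≥0
  , (p521⋡p44 , p44⋡p521)
  , (refl , H44-H521≥0 , p44⋡p521)
  , degree-minimal
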